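{- The emptiness and universality problems for PosSup and AsSup are decidable.
   Context: A probabilistic weighted automaton $A=\langle Q,\rho_I,\Sigma,\delta,\gamma\rangle$ consists of a finite set of states $Q$, an initial probability distribution $\rho_I$, a finite alphabet $\Sigma$, a probabilistic transition function $\delta: Q\times\Sigma\to\mathcal{D}(Q)$ and a rational weight function $\gamma: Q\times\Sigma\times Q\to\mathbb{Q}$. The value of a run with weight sequence $v_0v_1\dots$ is $\mathsf{Sup}(v)=\sup_n v_n$. Under the positive semantics $L^{>0}_A(w)=\sup\{\eta\mid\mathbb{P}(\{r\text{ run over }w\mid\mathsf{Sup}(\gamma(r))\ge\eta\})>0\}$; under the almost-sure semantics $L^{=1}_A(w)$ is defined the same way with probability $=1$. PosSup and AsSup denote Sup-automata under positive and almost-sure semantics. Given $A$ and a rational $\nu$, the quantitative emptiness problem asks whether there is a word $w\in\Sigma^\omega$ with $L_A(w)\ge\nu$, and the quantitative universality problem asks whether $L_A(w)\ge\nu$ for all $w\in\Sigma^\omega$.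
   Formalization: The initial distribution and the transition probabilities of the automaton are taken to be rational numbers (the weights and the threshold are rational in the statement itself). -}

module Defs where

open import Data.Nat using (ℕ; zero; suc)
open import Data.Fin using (Fin)
open import Data.List using (List; foldr; map)
open import Data.List using () renaming (allFin to allFinL)
open import Data.Rational using (ℚ; 0ℚ; 1ℚ; _+_; _*_; _-_; _≤_; _<_)
open import Data.Product using (Σ; ∃; _×_)
open import Relation.Binary.PropositionalEquality using (_≡_)
open import Relation.Nullary using (Dec; yes; no)
open import Data.Rational using (_<?_)

∑ : {n : ℕ} → (Fin n → ℚ) → ℚ
∑ {n} f = foldr _+_ 0ℚ (map f (allFinL n))

IsDistribution : {n : ℕ} → (Fin n → ℚ) → Set
IsDistribution {n} d = ((q : Fin n) → 0ℚ ≤ d q) × (∑ d ≡ 1ℚ)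

record PWA (nQ nΣ : ℕ) : Set where
  field
    ρI      : Fin nQ → ℚ
    ρI-dist : IsDistribution ρI
    δ       : Fin nQ → Fin nΣ → Fin nQ → ℚ
    δ-dist  : (q : Fin nQ) (σ : Fin nΣ) → IsDistribution (δ q σ)
    γ       : Fin nQ → Fin nΣ → Fin nQ → ℚ

Word : ℕ → Set
Word nΣ = ℕ → Fin nΣ

[_<_] : ℚ → ℚ → ℚ
[ x < y ] with x <? y
... | yes _ = 1ℚ
... | no  _ = 0ℚ

-- noHit A w η N q : probability mass of the runs over w whose first N
-- weights v_0 … v_{N-1} are all < η and whose N-th state is q.
noHit : {nQ nΣ : ℕ} → PWA nQ nΣ → Word nΣ → ℚ → ℕ → Fin nQ → ℚ
noHit A w η zero q = PWA.ρI A q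
noHit A w η (suc N) q' =
  ∑ (λ q → noHit A w η N q * (PWA.δ A q (w N) q' * [ PWA.γ A q (w N) q' < η ]))

-- P_N = probability that some weight among v_0 … v_{N-1} is ≥ η.
-- The event {Sup(γ(r)) ≥ η} = ⋃_N {∃ n < N. v_n ≥ η} (weights range over a
-- finite set, so the sup is attained); its probability is lim_N P_N = sup_N P_N.
probHitBy : {nQ nΣ : ℕ} → PWA nQ nΣ → Word nΣ → ℚ → ℕ → ℚ
probHitBy A w η N = 1ℚ - ∑ (noHit A w η N)

-- P({r | Sup(γ(r)) ≥ η}) > 0
PosProb : {nQ nΣ : ℕ} → PWA nQ nΣ → Word nΣ → ℚ → Set
PosProb A w η = ∃ λ N → 0ℚ < probHitBy A w η N

-- P({r | Sup(γ(r)) ≥ η}) = 1, i.e. sup_N P_N = 1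
AsProb : {nQ nΣ : ℕ} → PWA nQ nΣ → Word nΣ → ℚ → Set
AsProb A w η = (ε : ℚ) → 0ℚ < ε → ∃ λ N → 1ℚ - ε < probHitBy A w η N

data Semantics : Set where
  positive almostSure : Semantics

Event : Semantics → {nQ nΣ : ℕ} → PWA nQ nΣ → Word nΣ → ℚ → Set
Event positive   = PosProb
Event almostSure = AsProb

-- L_A(w) ≥ ν, where L_A(w) = sup { η | Event η }:
-- the sup is ≥ ν iff every η < ν is exceeded by some member of the set.
ValueGeq : Semantics → {nQ nΣ : ℕ} → PWA nQ nΣ → Word nΣ → ℚ → Set
ValueGeq s A w ν = (η : ℚ) → η < ν → Σ ℚ λ η' → (η < η') × Event s A w η'

NonEmpty : Semantics → {nQ nΣ : ℕ} → PWA nQ nΣ → ℚ → Set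
NonEmpty s {nΣ = nΣ} A ν = Σ (Word nΣ) λ w → ValueGeq s A w ν

Universal : Semantics → {nQ nΣ : ℕ} → PWA nQ nΣ → ℚ → Set
Universal s {nΣ = nΣ} A ν = (w : Word nΣ) → ValueGeq s A w ν

{-# OPTIONS --safe #-}

-- Fix the threshold ν. Since only finitely many weights occur, L(w) ≥ ν holds iff the runs over w
-- that ever see a weight ≥ ν (that "hit") have positive probability, resp. probability one. Runs
-- that have not yet hit evolve under substochastic matrices indexed by letters, and a finite word u
-- matters only through its behaviour: which states it connects with positive probability without
-- hitting, and from which states it hits with positive probability. There are finitely many
-- behaviours and they form a left congruence, so words can be pumped and searched for.
--   * Some word hits with positive probability iff some finite word does.
--   * Every word hits with positive probability iff every word of length the number of behaviours
--     does: a longer miss can be pumped to an infinite one.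
--   * Every word hits almost surely iff no reachable state admits a word of that length which
--     misses; in that case the surviving mass shrinks by a constant factor per block.
--   * Some word hits almost surely iff there are x and nonempty y such that y maps the support
--     after x into itself and can hit from each of its states: x y^ω is then such a word, and
--     conversely a pigeonhole on supports along an almost surely hitting word provides x and y.

module Submission where

open import Defs
open import Algebra.Bundles using (CommutativeRing)
open import Data.Empty using (⊥-elim)
open import Data.Fin as Fin using (Fin; zero; suc; toℕ; fromℕ<; combine; funToFin; finToFun)
open import Data.Fin.Properties
  using (any?; all?; pigeonhole; toℕ<n; toℕ-fromℕ<; finToFun-funToFin; combine-injective)
open import Data.Integer as ℤ using (+[1+_]; +0; 1ℤ)
open import Data.Integer.Properties as ℤₚ using ()
open import Data.List
  using (List; []; _∷_; _++_; _∷ʳ_; length; drop; take; applyUpTo; concat; replicate; foldl; foldr)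
open import Data.List.Properties
  using (map-tabulate; take++drop≡id; length-++; ++-assoc; ++-identityʳ; foldl-++;
         length-applyUpTo; applyUpTo-∷ʳ)
open import Data.Nat as ℕ using (ℕ; zero; suc; s≤s)
open import Data.Nat.Coprimality using (Coprime)
open import Data.Nat.Induction using (<-wellFounded; Acc; acc)
open import Data.Nat.Properties as ℕₚ using ()
open import Data.Product using (∃; _×_; _,_; proj₁; proj₂)
open import Data.Rational hiding (truncate)
  renaming (positive to 0<⇒Positive; nonNegative to 0≤⇒NonNegative)
open import Data.Rational.Properties
open import Data.Rational.Unnormalised as ℚᵘ using ()
open import Data.Rational.Unnormalised.Properties as ℚᵘₚ using ()
open import Data.Sum using (_⊎_; inj₁; inj₂; map₂)
open import Function using (_∘_; id)
open import Relation.Binary.Definitions using (tri<; tri≈; tri>)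
open import Relation.Binary.PropositionalEquality hiding ([_])
open import Relation.Nullary using (¬_; Dec; yes; no)
open import Relation.Nullary.Decidable using (map′; _×-dec_; _→-dec_; ¬?; decidable-stable)
open import Relation.Unary using (Decidable)
open import Algebra.Properties.Semiring.Sum (CommutativeRing.semiring +-*-commutativeRing)
  using (sum; sum-cong-≗; ∑-comm; *-distribˡ-sum; *-distribʳ-sum)

-- Finite sums and inequalities of rationals

<⇒≱ : ∀ {x y} → x < y → ¬ (y ≤ x)
<⇒≱ x<y y≤x = <-irrefl refl (<-≤-trans x<y y≤x)

∑-suc : ∀ {n} (f : Fin (suc n) → ℚ) → ∑ f ≡ f zero + ∑ (f ∘ suc)
∑-suc f = cong (λ l → f zero + foldr _+_ 0ℚ l)
  (trans (map-tabulate suc f) (sym (map-tabulate id (f ∘ suc))))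

∑≡sum : ∀ {n} (f : Fin n → ℚ) → ∑ f ≡ sum f
∑≡sum {zero}  f = refl
∑≡sum {suc n} f = trans (∑-suc f) (cong (f zero +_) (∑≡sum (f ∘ suc)))

∑-cong : ∀ {n} {f g : Fin n → ℚ} → (∀ i → f i ≡ g i) → ∑ f ≡ ∑ g
∑-cong {f = f} {g} f≗g = trans (∑≡sum f) (trans (sum-cong-≗ f≗g) (sym (∑≡sum g)))

∑-swap : ∀ {m n} (f : Fin m → Fin n → ℚ) →
  ∑ (λ i → ∑ (λ j → f i j)) ≡ ∑ (λ j → ∑ (λ i → f i j))
∑-swap f = begin
  ∑ (λ i → ∑ (f i))               ≡⟨ ∑-cong (λ i → ∑≡sum (f i)) ⟩
  ∑ (λ i → sum (f i))             ≡⟨ ∑≡sum (λ i → sum (f i)) ⟩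
  sum (λ i → sum (f i))           ≡⟨ ∑-comm f ⟩
  sum (λ j → sum (λ i → f i j))   ≡⟨ ∑≡sum (λ j → sum (λ i → f i j)) ⟨
  ∑ (λ j → sum (λ i → f i j))     ≡⟨ ∑-cong (λ j → ∑≡sum (λ i → f i j)) ⟨
  ∑ (λ j → ∑ (λ i → f i j))       ∎
  where open ≡-Reasoning

*-distribˡ-∑ : ∀ {n} c (f : Fin n → ℚ) → c * ∑ f ≡ ∑ (λ i → c * f i)
*-distribˡ-∑ c f =
  trans (cong (c *_) (∑≡sum f)) (trans (*-distribˡ-sum c f) (sym (∑≡sum (λ i → c * f i))))

*-distribʳ-∑ : ∀ {n} c (f : Fin n → ℚ) → ∑ f * c ≡ ∑ (λ i → f i * c)
*-distribʳ-∑ c f =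
  trans (cong (_* c) (∑≡sum f)) (trans (*-distribʳ-sum c f) (sym (∑≡sum (λ i → f i * c))))

∑-mono-≤ : ∀ {n} {f g : Fin n → ℚ} → (∀ i → f i ≤ g i) → ∑ f ≤ ∑ g
∑-mono-≤ {zero}              f≤g = ≤-refl
∑-mono-≤ {suc n} {f} {g} f≤g rewrite ∑-suc f | ∑-suc g =
  +-mono-≤ (f≤g zero) (∑-mono-≤ (f≤g ∘ suc))

∑-mono-< : ∀ {n} {f g : Fin n → ℚ} → (∀ i → f i ≤ g i) → ∀ i → f i < g i → ∑ f < ∑ g
∑-mono-< {suc n} {f} {g} f≤g zero fi<gi rewrite ∑-suc f | ∑-suc g =
  +-mono-<-≤ fi<gi (∑-mono-≤ (f≤g ∘ suc))
∑-mono-< {suc n} {f} {g} f≤g (suc i) fi<gi rewrite ∑-suc f | ∑-suc g =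
  +-mono-≤-< (f≤g zero) (∑-mono-< (f≤g ∘ suc) i fi<gi)

∑-<⇒∃< : ∀ {n} {f g : Fin n → ℚ} → ∑ f < ∑ g → ∃ λ i → f i < g i
∑-<⇒∃< {zero} f<g = ⊥-elim (<-irrefl refl f<g)
∑-<⇒∃< {suc n} {f} {g} f<g with f zero <? g zero
... | yes f0<g0 = zero , f0<g0
... | no  f0≮g0 with ∑ (f ∘ suc) <? ∑ (g ∘ suc)
...   | yes lt = let (i , fi<gi) = ∑-<⇒∃< lt in suc i , fi<gi
...   | no  ≮  = ⊥-elim (<⇒≱ f<g
  (subst₂ _≤_ (sym (∑-suc g)) (sym (∑-suc f)) (+-mono-≤ (≮⇒≥ f0≮g0) (≮⇒≥ ≮))))

∑-zero : ∀ n → ∑ {n} (λ _ → 0ℚ) ≡ 0ℚ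
∑-zero zero    = refl
∑-zero (suc n) = trans (∑-suc {n} (λ _ → 0ℚ)) (trans (+-identityˡ (∑ {n} (λ _ → 0ℚ))) (∑-zero n))

∑-nonneg : ∀ {n} {f : Fin n → ℚ} → (∀ i → 0ℚ ≤ f i) → 0ℚ ≤ ∑ f
∑-nonneg {n} {f} 0≤f = subst (_≤ ∑ f) (∑-zero n) (∑-mono-≤ 0≤f)

∑-positive : ∀ {n} {f : Fin n → ℚ} → (∀ i → 0ℚ ≤ f i) → ∀ i → 0ℚ < f i → 0ℚ < ∑ f
∑-positive {n} {f} 0≤f i 0<fi = subst (_< ∑ f) (∑-zero n) (∑-mono-< 0≤f i 0<fi)

∑-positive⁻¹ : ∀ {n} {f : Fin n → ℚ} → 0ℚ < ∑ f → ∃ λ i → 0ℚ < f i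
∑-positive⁻¹ {n} {f} 0<∑f = ∑-<⇒∃< (subst (_< ∑ f) (sym (∑-zero n)) 0<∑f)

term≤∑ : ∀ {n} {f : Fin n → ℚ} → (∀ i → 0ℚ ≤ f i) → ∀ i → f i ≤ ∑ f
term≤∑ {suc n} {f} 0≤f zero rewrite ∑-suc f =
  subst (_≤ f zero + ∑ (f ∘ suc)) (+-identityʳ _) (+-monoʳ-≤ (f zero) (∑-nonneg (0≤f ∘ suc)))
term≤∑ {suc n} {f} 0≤f (suc i) rewrite ∑-suc f =
  subst (_≤ f zero + ∑ (f ∘ suc)) (+-identityˡ _) (+-mono-≤ (0≤f zero) (term≤∑ (0≤f ∘ suc) i))

*-monoˡ : ∀ {c x y} → 0ℚ ≤ c → x ≤ y → c * x ≤ c * y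
*-monoˡ {c} 0≤c = *-monoˡ-≤-nonNeg c {{0≤⇒NonNegative 0≤c}}

*-nonneg : ∀ {x y} → 0ℚ ≤ x → 0ℚ ≤ y → 0ℚ ≤ x * y
*-nonneg {x} {y} 0≤x 0≤y = subst (_≤ x * y) (*-zeroʳ x) (*-monoˡ 0≤x 0≤y)

*-monoˡ-< : ∀ {c x y} → 0ℚ < c → x < y → c * x < c * y
*-monoˡ-< {c} 0<c = *-monoʳ-<-pos c {{0<⇒Positive 0<c}}

*-positive : ∀ {x y} → 0ℚ < x → 0ℚ < y → 0ℚ < x * y
*-positive {x} {y} 0<x 0<y = subst (_< x * y) (*-zeroʳ x) (*-monoˡ-< 0<x 0<y)

*-cancel-< : ∀ {c x y} → 0ℚ ≤ c → c * x < c * y → x < y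
*-cancel-< {c} 0≤c = *-cancelˡ-<-nonNeg c {{0≤⇒NonNegative 0≤c}}

*-≤-unit : ∀ {c x} → 0ℚ ≤ c → x ≤ 1ℚ → c * x ≤ c
*-≤-unit {c} {x} 0≤c x≤1 = subst (c * x ≤_) (*-identityʳ c) (*-monoˡ 0≤c x≤1)

*-<-unit : ∀ {c x} → 0ℚ < c → x < 1ℚ → c * x < c
*-<-unit {c} {x} 0<c x<1 = subst (c * x <_) (*-identityʳ c) (*-monoˡ-< 0<c x<1)

nonneg-cases : ∀ {x} → 0ℚ ≤ x → 0ℚ < x ⊎ x ≡ 0ℚ
nonneg-cases {x} 0≤x with <-cmp 0ℚ x
... | tri< 0<x _ _ = inj₁ 0<x
... | tri≈ _ 0≡x _ = inj₂ (sym 0≡x)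
... | tri> _ _ x<0 = ⊥-elim (<⇒≱ x<0 0≤x)

*-positive⁻¹ : ∀ {x y} → 0ℚ ≤ x → 0ℚ ≤ y → 0ℚ < x * y → 0ℚ < x × 0ℚ < y
*-positive⁻¹ {x} {y} 0≤x 0≤y 0<xy with nonneg-cases 0≤x
... | inj₂ refl = ⊥-elim (<-irrefl (sym (*-zeroˡ y)) 0<xy)
... | inj₁ 0<x  = 0<x , *-cancel-< 0≤x (subst (_< x * y) (sym (*-zeroʳ x)) 0<xy)

*-<-unit⁻¹ : ∀ {c x} → 0ℚ ≤ c → c * x < c → 0ℚ < c × x < 1ℚ
*-<-unit⁻¹ {c} {x} 0≤c cx<c with nonneg-cases 0≤c
... | inj₂ refl = ⊥-elim (<-irrefl (*-zeroˡ x) cx<c)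
... | inj₁ 0<c  = 0<c , *-cancel-< 0≤c (subst (c * x <_) (sym (*-identityʳ c)) cx<c)

p<q⇒0<q-p : ∀ {p q} → p < q → 0ℚ < q - p
p<q⇒0<q-p {p} {q} p<q = subst (_< q - p) (+-inverseʳ p) (+-monoˡ-< (- p) p<q)

q-p+p : ∀ p q → (q - p) + p ≡ q
q-p+p p q = trans (+-assoc q (- p) p) (trans (cong (λ z → q + z) (+-inverseˡ p)) (+-identityʳ q))

0<q-p⇒p<q : ∀ {p q} → 0ℚ < q - p → p < q
0<q-p⇒p<q {p} {q} 0<q-p = subst₂ _<_ (+-identityˡ p) (q-p+p p q) (+-monoˡ-< p 0<q-p)

-- The bound is the maximum of `ν - 1` and the values below `ν`. It isolates the threshold from the
-- weights and, with `ν` equal to 1, turns finitely many survival probabilities into one contraction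
-- factor.
gap : ∀ ν {n} (x : Fin n → ℚ) → ∃ λ c → c < ν × (∀ i → x i < ν → x i ≤ c)
gap ν {zero} x = ν - 1ℚ ,
  subst (ν - 1ℚ <_) (+-identityʳ ν) (+-monoʳ-< ν (negative⁻¹ (- 1ℚ))) , λ ()
gap ν {suc n} x with gap ν (x ∘ suc) | x zero <? ν
... | c , c<ν , bound | no x₀≮ν = c , c<ν , λ where
  zero    x₀<ν → ⊥-elim (x₀≮ν x₀<ν)
  (suc i) xᵢ<ν → bound i xᵢ<ν
... | c , c<ν , bound | yes x₀<ν = c ⊔ x zero , ⊔-pres-<ν , ≤⊔
  where
  ⊔-pres-<ν : c ⊔ x zero < ν
  ⊔-pres-<ν with ⊔-sel c (x zero)
  ... | inj₁ eq = subst (_< ν) (sym eq) c<ν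
  ... | inj₂ eq = subst (_< ν) (sym eq) x₀<ν
  ≤⊔ : ∀ i → x i < ν → x i ≤ c ⊔ x zero
  ≤⊔ zero    _    = p≤q⊔p c (x zero)
  ≤⊔ (suc i) xᵢ<ν = ≤-trans (bound i xᵢ<ν) (p≤p⊔q c (x zero))

-- Induction on the length: one bound for each first letter, then a bound over these finitely many
-- bounds.
gap-words : ∀ ν {k} L (x : List (Fin k) → ℚ) →
  ∃ λ c → c < ν × (∀ u → length u ≡ L → x u < ν → x u ≤ c)
gap-words ν zero x =
  let (c , c<ν , bound) = gap ν {1} (λ _ → x [])
  in c , c<ν , λ where [] refl x<ν → bound zero x<ν
gap-words ν (suc L) x =
  let rec a = gap-words ν L (x ∘ (a ∷_))
      (c , c<ν , bound) = gap ν (proj₁ ∘ rec)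
  in c , c<ν , λ where
       (a ∷ u) refl x<ν → ≤-trans (proj₂ (proj₂ (rec a)) u refl x<ν)
                                  (bound a (proj₁ (proj₂ (rec a))))

infixr 8 _·_
_·_ : ℕ → ℚ → ℚ
zero  · d = 0ℚ
suc k · d = d + k · d

-- In unnormalised rationals the `k`-fold sum keeps the denominator of the summand, so no gcd
-- enters.
toℚᵘ-· : ∀ k n b .(c : Coprime ℤ.∣ n ∣ (suc b)) →
  ℚᵘ._≃_ (toℚᵘ (k · mkℚ n b c)) (ℚᵘ.mkℚᵘ (ℤ.+ k ℤ.* n) b)
toℚᵘ-· zero n b c = ℚᵘ.*≡* (cong (ℤ._* 1ℤ) (sym (ℤₚ.*-zeroˡ n)))
toℚᵘ-· (suc k) n b c = begin
  toℚᵘ (d + k · d)                                      ≈⟨ toℚᵘ-homo-+ d (k · d) ⟩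
  ℚᵘ.mkℚᵘ n b ℚᵘ.+ toℚᵘ (k · d)                         ≈⟨ ℚᵘₚ.+-congʳ _ (toℚᵘ-· k n b c) ⟩
  ℚᵘ.mkℚᵘ n b ℚᵘ.+ ℚᵘ.mkℚᵘ (ℤ.+ k ℤ.* n) b              ≈⟨ ℚᵘ.*≡* same-denominator ⟩
  ℚᵘ.mkℚᵘ (ℤ.+ suc k ℤ.* n) b                           ∎
  where
  open import Relation.Binary.Reasoning.Setoid ℚᵘₚ.≃-setoid
  d = mkℚ n b c
  β = ℤ.+ suc b
  same-denominator : (n ℤ.* β ℤ.+ (ℤ.+ k ℤ.* n) ℤ.* β) ℤ.* β ≡ (ℤ.+ suc k ℤ.* n) ℤ.* (β ℤ.* β)
  same-denominator =
    trans (cong (ℤ._* β) (sym (ℤₚ.*-distribʳ-+ β n (ℤ.+ k ℤ.* n))))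
    (trans (ℤₚ.*-assoc (n ℤ.+ ℤ.+ k ℤ.* n) β β)
           (cong (ℤ._* (β ℤ.* β)) (sym (ℤₚ.suc-* (ℤ.+ k) n))))

-- A positive numerator is at least 1, so as many copies as the denominator `suc b` suffice.
archimedean : ∀ d → 0ℚ < d → ∃ λ k → 1ℚ ≤ k · d
archimedean (mkℚ +0       b c) (*<* (ℤ.+<+ ()))
archimedean (mkℚ +[1+ a ] b c) 0<d = suc b , toℚᵘ-cancel-≤
  (ℚᵘₚ.≤-respʳ-≃ (ℚᵘₚ.≃-sym (toℚᵘ-· (suc b) +[1+ a ] b c)) (ℚᵘ.*≤* (ℤ.+≤+ b≤)))
  where
  b≤ : 1 ℕ.* suc b ℕ.≤ (suc b ℕ.* suc a) ℕ.* 1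
  b≤ = subst₂ ℕ._≤_ (sym (ℕₚ.*-identityˡ (suc b))) (sym (ℕₚ.*-identityʳ _)) (ℕₚ.m≤m*n (suc b) (suc a))

-- As long as g stays ≥ ε, each step loses at least (1 − c)ε.
contraction⇒vanishes : ∀ {c} (g : ℕ → ℚ) → c < 1ℚ → (∀ k → 0ℚ ≤ g k) → g 0 ≤ 1ℚ →
  (∀ k → g (suc k) ≤ c * g k) → ∀ ε → 0ℚ < ε → ∃ λ k → g k < ε
contraction⇒vanishes {c} g c<1 0≤g g0≤1 contracts ε 0<ε = search (descend K)
  where
  0<1-c = p<q⇒0<q-p c<1
  d = (1ℚ - c) * ε
  arch = archimedean d (*-positive 0<1-c 0<ε)
  -- One summand beyond the Archimedean bound makes `1 < K · d` strict, against `g K + K · d ≤ 1`.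
  K = suc (proj₁ arch)

  step : ∀ k → ε ≤ g k → g (suc k) + d ≤ g k
  step k ε≤gk = begin
    g (suc k) + d                  ≤⟨ +-mono-≤ (contracts k) (*-monoˡ (<⇒≤ 0<1-c) ε≤gk) ⟩
    c * g k + (1ℚ - c) * g k       ≡⟨ *-distribʳ-+ (g k) c (1ℚ - c) ⟨
    (c + (1ℚ - c)) * g k           ≡⟨ cong (_* g k) (trans (+-comm c _) (q-p+p c 1ℚ)) ⟩
    1ℚ * g k                       ≡⟨ *-identityˡ (g k) ⟩
    g k                            ∎
    where open ≤-Reasoning

  descend : ∀ k → (∃ λ j → g j < ε) ⊎ (g k + k · d ≤ 1ℚ)
  descend zero = inj₂ (subst (_≤ 1ℚ) (sym (+-identityʳ _)) g0≤1)
  descend (suc k) with descend k | g k <? ε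
  ... | inj₁ found | _        = inj₁ found
  ... | inj₂ _     | yes gk<ε = inj₁ (k , gk<ε)
  ... | inj₂ le    | no  gk≮ε = inj₂ (begin
    g (suc k) + (d + k · d)   ≡⟨ +-assoc (g (suc k)) d (k · d) ⟨
    (g (suc k) + d) + k · d   ≤⟨ +-monoˡ-≤ (k · d) (step k (≮⇒≥ gk≮ε)) ⟩
    g k + k · d               ≤⟨ le ⟩
    1ℚ                        ∎)
    where open ≤-Reasoning

  search : (∃ λ j → g j < ε) ⊎ (g K + K · d ≤ 1ℚ) → ∃ λ j → g j < ε
  search (inj₁ found) = found
  search (inj₂ le) = ⊥-elim (<⇒≱ 1<Kd (begin
    K · d          ≡⟨ +-identityˡ _ ⟨
    0ℚ + K · d     ≤⟨ +-monoˡ-≤ (K · d) (0≤g K) ⟩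
    g K + K · d    ≤⟨ le ⟩
    1ℚ             ∎))
    where
    open ≤-Reasoning
    1<Kd : 1ℚ < K · d
    1<Kd = subst (_< K · d) (+-identityˡ 1ℚ) (+-mono-<-≤ (*-positive 0<1-c 0<ε) (proj₂ arch))

-- Words and finite-index left congruences

bit : ∀ {P : Set} → Dec P → Fin 2
bit (yes _) = suc zero
bit (no  _) = zero

bit-≡⇒ : ∀ {P Q : Set} (p? : Dec P) (q? : Dec Q) → bit p? ≡ bit q? → P → Q
bit-≡⇒ _        (yes q) _ _ = q
bit-≡⇒ (no ¬p)  (no  _) _ p = ⊥-elim (¬p p)

⇔⇒bit-≡ : ∀ {P Q : Set} (p? : Dec P) (q? : Dec Q) → (P → Q) → (Q → P) → bit p? ≡ bit q?
⇔⇒bit-≡ (yes _) (yes _) _ _ = refl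
⇔⇒bit-≡ (no  _) (no  _) _ _ = refl
⇔⇒bit-≡ (yes p) (no ¬q) f _ = ⊥-elim (¬q (f p))
⇔⇒bit-≡ (no ¬p) (yes q) _ g = ⊥-elim (¬p (g q))

funToFin-cong : ∀ {m n} {f g : Fin m → Fin n} → (∀ i → f i ≡ g i) → funToFin f ≡ funToFin g
funToFin-cong {zero}  f≗g = refl
funToFin-cong {suc m} f≗g = cong₂ combine (f≗g zero) (funToFin-cong (f≗g ∘ suc))

funToFin-injective : ∀ {m n} (f g : Fin m → Fin n) → funToFin f ≡ funToFin g → ∀ i → f i ≡ g i
funToFin-injective f g eq i =
  trans (sym (finToFun-funToFin f i))
        (trans (cong (λ code → finToFun code i) eq) (finToFun-funToFin g i))

-- Subsets become elements of a finite type, so that the pigeonhole principle applies and equality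
-- of codes means pointwise equivalence without function extensionality.
subsetCode : ∀ {n} {P : Fin n → Set} → Decidable P → Fin (2 ℕ.^ n)
subsetCode P? = funToFin (bit ∘ P?)

subsetCode-⇒ : ∀ {n} {P Q : Fin n → Set} (P? : Decidable P) (Q? : Decidable Q) →
  subsetCode P? ≡ subsetCode Q? → ∀ i → P i → Q i
subsetCode-⇒ P? Q? eq i =
  bit-≡⇒ (P? i) (Q? i) (funToFin-injective (bit ∘ P?) (bit ∘ Q?) eq i)

⇔⇒subsetCode-≡ : ∀ {n} {P Q : Fin n → Set} (P? : Decidable P) (Q? : Decidable Q) →
  (∀ i → P i → Q i) → (∀ i → Q i → P i) → subsetCode P? ≡ subsetCode Q?
⇔⇒subsetCode-≡ P? Q? P⇒Q Q⇒P =
  funToFin-cong (λ i → ⇔⇒bit-≡ (P? i) (Q? i) (P⇒Q i) (Q⇒P i))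

-- The sum of the individual bounds serves, since each property persists upwards.
common-bound : ∀ {n} (P : Fin n → ℕ → Set) → (∀ i d e → P i d → P i (d ℕ.+ e)) →
  (∀ i → ∃ (P i)) → ∃ λ d → ∀ i → P i d
common-bound {zero} P up bounded = 0 , λ ()
common-bound {suc n} P up bounded =
  let (d₀ , p₀) = bounded zero
      (d , p) = common-bound (P ∘ suc) (up ∘ suc) (bounded ∘ suc)
  in d₀ ℕ.+ d , λ where
       zero    → up zero d₀ d p₀
       (suc i) → subst (P (suc i)) (ℕₚ.+-comm d d₀) (up (suc i) d d₀ (p i))

prefix : ∀ {A : Set} → (ℕ → A) → ℕ → List A
prefix = applyUpTo

shift : ∀ {A : Set} → (ℕ → A) → ℕ → (ℕ → A)
shift w N t = w (N ℕ.+ t)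

prefix-+ : ∀ {A : Set} (w : ℕ → A) N M → prefix w (N ℕ.+ M) ≡ prefix w N ++ prefix (shift w N) M
prefix-+ w zero    M = refl
prefix-+ w (suc N) M = cong (w 0 ∷_) (prefix-+ (w ∘ suc) N M)

-- The infinite word x (b y)^ω.
lasso : ∀ {A : Set} → List A → A → List A → ℕ → A
lasso []      b y zero    = b
lasso []      b y (suc t) = lasso y b y t
lasso (a ∷ x) b y zero    = a
lasso (a ∷ x) b y (suc t) = lasso x b y t

prefix-lasso-++ : ∀ {A : Set} (x x′ : List A) b y N →
  prefix (lasso (x ++ x′) b y) (length x ℕ.+ N) ≡ x ++ prefix (lasso x′ b y) N
prefix-lasso-++ []      x′ b y N = refl
prefix-lasso-++ (a ∷ x) x′ b y N = cong (a ∷_) (prefix-lasso-++ x x′ b y N)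

prefix-lasso : ∀ {A : Set} (x : List A) b y N →
  prefix (lasso x b y) (length x ℕ.+ N) ≡ x ++ prefix (lasso [] b y) N
prefix-lasso x b y N =
  subst (λ x′ → prefix (lasso x′ b y) (length x ℕ.+ N) ≡ x ++ prefix (lasso [] b y) N)
        (++-identityʳ x) (prefix-lasso-++ x [] b y N)

power : ∀ {A : Set} → ℕ → List A → List A
power k y = concat (replicate k y)

prefix-cycle : ∀ {A : Set} b (y : List A) k →
  prefix (lasso [] b y) (k ℕ.* length (b ∷ y)) ≡ power k (b ∷ y)
prefix-cycle b y zero    = refl
prefix-cycle b y (suc k) =
  cong (b ∷_) (trans (prefix-lasso y b y (k ℕ.* length (b ∷ y))) (cong (y ++_) (prefix-cycle b y k)))

-- Phrased with suffixes because repetitions are sought among the suffixes of a word; `i < j` makes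
-- the middle factor nonempty, whence its explicit head `b`.
split-at : ∀ {A : Set} (u : List A) i j → i ℕ.< j → j ℕ.≤ length u →
  ∃ λ x → ∃ λ b → ∃ λ y → u ≡ x ++ (b ∷ y) ++ drop j u × drop i u ≡ (b ∷ y) ++ drop j u
split-at (b ∷ u) zero (suc j) _ _ =
  [] , b , take j u , u≡ , u≡
  where u≡ = cong (b ∷_) (sym (take++drop≡id j u))
split-at (a ∷ u) (suc i) (suc j) (s≤s i<j) (s≤s j≤) =
  let (x , b , y , u≡ , drop≡) = split-at u i j i<j j≤
  in a ∷ x , b , y , cong (a ∷_) u≡ , drop≡

any-word? : ∀ {k} L {P : List (Fin k) → Set} → Decidable P → Dec (∃ λ u → length u ≡ L × P u)
any-word? zero P? = map′ (λ p → [] , refl , p) (λ where ([] , refl , p) → p) (P? [])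
any-word? (suc L) P? =
  map′ (λ where (a , u , refl , p) → a ∷ u , refl , p)
       (λ where (a ∷ u , refl , p) → a , u , refl , p)
       (any? (λ a → any-word? L (P? ∘ (a ∷_))))

module LeftCongruence {k K : ℕ} (f : List (Fin k) → Fin K)
  (∷-cong : ∀ a {u v} → f u ≡ f v → f (a ∷ u) ≡ f (a ∷ v)) where

  ++-congˡ : ∀ x {u v} → f u ≡ f v → f (x ++ u) ≡ f (x ++ v)
  ++-congˡ []      eq = eq
  ++-congˡ (a ∷ x) eq = ∷-cong a (++-congˡ x eq)

  -- The suffixes at the positions from 0 to `K` are one more than there are classes, so two of them
  -- agree.
  repetition : ∀ u → K ℕ.≤ length u →
    ∃ λ x → ∃ λ b → ∃ λ y → ∃ λ z → u ≡ x ++ (b ∷ y) ++ z × f ((b ∷ y) ++ z) ≡ f z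
  repetition u K≤ =
    let (i , j , i<j , fᵢ≡fⱼ) = pigeonhole (ℕₚ.n<1+n K) (λ i → f (drop (toℕ i) u))
        (x , b , y , u≡ , drop≡) =
          split-at u (toℕ i) (toℕ j) i<j (ℕₚ.≤-trans (ℕₚ.≤-pred (toℕ<n j)) K≤)
    in x , b , y , drop (toℕ j) u , u≡ , trans (cong f (sym drop≡)) fᵢ≡fⱼ

  power-invariant : ∀ y {z} → f (y ++ z) ≡ f z → ∀ n → f (power n y ++ z) ≡ f z
  power-invariant y     eq zero    = refl
  power-invariant y {z} eq (suc n) =
    trans (cong f (++-assoc y (power n y) z)) (trans (++-congˡ y (power-invariant y eq n)) eq)

  -- With `u` equal to `x (b y) z`, every prefix of the lasso extends to some `x (b y)^N z`, and the
  -- class does not depend on the number of rounds.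
  pump : ∀ u → K ℕ.≤ length u → ∃ λ x → ∃ λ b → ∃ λ y →
    ∀ N → ∃ λ v → f (prefix (lasso x b y) N ++ v) ≡ f u
  pump u K≤ with repetition u K≤
  ... | x , b , y , z , refl , loop = x , b , y , λ N →
    let w = lasso x b y
        -- The end of the `N`-th round; it lies at or beyond `N` because the period is nonempty.
        M = length x ℕ.+ N ℕ.* length (b ∷ y)
        N≤M = ℕₚ.≤-trans (ℕₚ.m≤m*n N (length (b ∷ y))) (ℕₚ.m≤n+m _ (length x))
        -- The rest of the lasso up to `M`, followed by the tail `z`.
        v = prefix (shift w N) (M ℕ.∸ N) ++ z
        word≡ : prefix w N ++ v ≡ x ++ power N (b ∷ y) ++ z
        word≡ = begin
          prefix w N ++ prefix (shift w N) (M ℕ.∸ N) ++ z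
            ≡⟨ ++-assoc (prefix w N) _ z ⟨
          (prefix w N ++ prefix (shift w N) (M ℕ.∸ N)) ++ z
            ≡⟨ cong (_++ z) (prefix-+ w N (M ℕ.∸ N)) ⟨
          prefix w (N ℕ.+ (M ℕ.∸ N)) ++ z
            ≡⟨ cong (λ L → prefix w L ++ z) (ℕₚ.m+[n∸m]≡n N≤M) ⟩
          prefix w M ++ z
            ≡⟨ cong (_++ z) (prefix-lasso x b y _) ⟩
          (x ++ prefix (lasso [] b y) (N ℕ.* length (b ∷ y))) ++ z
            ≡⟨ cong (λ u′ → (x ++ u′) ++ z) (prefix-cycle b y N) ⟩
          (x ++ power N (b ∷ y)) ++ z
            ≡⟨ ++-assoc x _ z ⟩
          x ++ power N (b ∷ y) ++ z ∎
    in v , trans (cong f word≡)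
                 (++-congˡ x (trans (power-invariant (b ∷ y) loop N) (sym loop)))
    where open ≡-Reasoning

  -- Deleting the repeated factor keeps the class and shortens the word; this can go on until fewer
  -- than `K` letters remain.
  shorten : ∀ u → ∃ λ v → length v ℕ.< K × f v ≡ f u
  shorten u = go u (<-wellFounded (length u))
    where
    go : ∀ u → Acc ℕ._<_ (length u) → ∃ λ v → length v ℕ.< K × f v ≡ f u
    go u (acc rec) with K ℕ.≤? length u
    ... | no  K≰ = u , ℕₚ.≰⇒> K≰ , refl
    ... | yes K≤ with repetition u K≤
    ...   | x , b , y , z , refl , loop =
      let (v , short , v≡) = go (x ++ z) (rec shorter)
      in v , short , trans v≡ (++-congˡ x (sym loop))
      where
      shorter : length (x ++ z) ℕ.< length (x ++ (b ∷ y) ++ z)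
      shorter rewrite length-++ x {z} | length-++ x {(b ∷ y) ++ z} | length-++ y {z} =
        ℕₚ.+-monoʳ-< (length x) (s≤s (ℕₚ.m≤n+m (length z) (length y)))

  -- Every class that occurs contains a word shorter than `K`, so testing those words decides a
  -- property of classes.
  search : {P : List (Fin k) → Set} → Decidable P → (∀ {u v} → f u ≡ f v → P u → P v) → Dec (∃ P)
  search P? resp =
    map′ (λ where (_ , u , _ , p) → u , p)
         (λ where
           (u , p) →
             let (v , short , v≡) = shorten u
             in fromℕ< short , v , sym (toℕ-fromℕ< short) , resp (sym v≡) p)
         (any? {n = K} (λ i → any-word? (toℕ i) P?))

-- Substochastic matrices indexed by letters

-- m a q q′ is the probability of moving from q to q′ on a without hitting; the mass missing from a
-- row has hit.
module Substochastic {n k : ℕ} (m : Fin k → Fin n → Fin n → ℚ)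
  (0≤m : ∀ a q q′ → 0ℚ ≤ m a q q′) (row≤1 : ∀ a q → ∑ (m a q) ≤ 1ℚ) where

  step : (Fin n → ℚ) → Fin k → Fin n → ℚ
  step μ a q′ = ∑ (λ q → μ q * m a q q′)

  act : List (Fin k) → (Fin n → ℚ) → Fin n → ℚ
  act u μ = foldl step μ u

  -- Backward counterpart of `act`: the constant function 1 pulled back along the word.
  survival : List (Fin k) → Fin n → ℚ
  survival []      q = 1ℚ
  survival (a ∷ u) q = ∑ (λ q′ → m a q q′ * survival u q′)

  Reach : List (Fin k) → Fin n → Fin n → Set
  Reach []      q q′ = q ≡ q′
  Reach (a ∷ u) q q′ = ∃ λ q₁ → 0ℚ < m a q q₁ × Reach u q₁ q′

  Hit : List (Fin k) → Fin n → Set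
  Hit u q = survival u q < 1ℚ

  reach? : ∀ u q → Decidable (Reach u q)
  reach? []      q q′ = q Fin.≟ q′
  reach? (a ∷ u) q q′ = any? (λ q₁ → (0ℚ <? m a q q₁) ×-dec reach? u q₁ q′)

  hit? : ∀ u → Decidable (Hit u)
  hit? u q = survival u q <? 1ℚ

  survival≤1 : ∀ u q → survival u q ≤ 1ℚ
  survival≤1 []      q = ≤-refl
  survival≤1 (a ∷ u) q =
    ≤-trans (∑-mono-≤ (λ q′ → *-≤-unit (0≤m a q q′) (survival≤1 u q′))) (row≤1 a q)

  ¬hit⇒survival≡1 : ∀ u q → ¬ Hit u q → survival u q ≡ 1ℚ
  ¬hit⇒survival≡1 u q ¬hit = ≤-antisym (survival≤1 u q) (≮⇒≥ ¬hit)

  survival-++ : ∀ u v q → survival (u ++ v) q ≤ survival u q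
  survival-++ []      v q = survival≤1 v q
  survival-++ (a ∷ u) v q = ∑-mono-≤ (λ q′ → *-monoˡ (0≤m a q q′) (survival-++ u v q′))

  hit-++ : ∀ u v {q} → Hit u q → Hit (u ++ v) q
  hit-++ u v {q} = ≤-<-trans (survival-++ u v q)

  -- If the row of `a` loses nothing, a deficit of the weighted sum must come from a single
  -- successor. Hence hitting along `a ∷ u` depends on `u` only through `Hit u`.
  hit-∷⇒ : ∀ a u {q} → Hit (a ∷ u) q → ∑ (m a q) < 1ℚ ⊎ ∃ λ q′ → 0ℚ < m a q q′ × Hit u q′
  hit-∷⇒ a u {q} hit with ∑ (m a q) <? 1ℚ
  ... | yes row<1 = inj₁ row<1
  ... | no  row≮1 =
    let (q′ , lt) = ∑-<⇒∃< (<-≤-trans hit (≮⇒≥ row≮1))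
    in inj₂ (q′ , *-<-unit⁻¹ (0≤m a q q′) lt)

  hit-∷⇐ : ∀ a u {q} → ∑ (m a q) < 1ℚ ⊎ (∃ λ q′ → 0ℚ < m a q q′ × Hit u q′) → Hit (a ∷ u) q
  hit-∷⇐ a u {q} (inj₁ row<1) =
    ≤-<-trans (∑-mono-≤ (λ q′ → *-≤-unit (0≤m a q q′) (survival≤1 u q′))) row<1
  hit-∷⇐ a u {q} (inj₂ (q′ , 0<m , hit)) =
    <-≤-trans (∑-mono-< (λ q′ → *-≤-unit (0≤m a q q′) (survival≤1 u q′)) q′ (*-<-unit 0<m hit))
              (row≤1 a q)

  step-nonneg : ∀ {μ} → (∀ q → 0ℚ ≤ μ q) → ∀ a q → 0ℚ ≤ step μ a q
  step-nonneg 0≤μ a q′ = ∑-nonneg (λ q → *-nonneg (0≤μ q) (0≤m a q q′))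

  act-nonneg : ∀ u {μ} → (∀ q → 0ℚ ≤ μ q) → ∀ q → 0ℚ ≤ act u μ q
  act-nonneg []      0≤μ = 0≤μ
  act-nonneg (a ∷ u) 0≤μ = act-nonneg u (step-nonneg 0≤μ a)

  -- Duality: pushing `μ` forward and summing equals pairing `μ` with the survival function, by
  -- exchanging the two sums.
  ∑-act : ∀ u μ → ∑ (act u μ) ≡ ∑ (λ q → μ q * survival u q)
  ∑-act []      μ = ∑-cong (λ q → sym (*-identityʳ (μ q)))
  ∑-act (a ∷ u) μ = begin
    ∑ (act u (step μ a))
      ≡⟨ ∑-act u (step μ a) ⟩
    ∑ (λ q′ → ∑ (λ q → μ q * m a q q′) * survival u q′)
      ≡⟨ ∑-cong (λ q′ → *-distribʳ-∑ (survival u q′) (λ q → μ q * m a q q′)) ⟩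
    ∑ (λ q′ → ∑ (λ q → μ q * m a q q′ * survival u q′))
      ≡⟨ ∑-swap (λ q′ q → μ q * m a q q′ * survival u q′) ⟩
    ∑ (λ q → ∑ (λ q′ → μ q * m a q q′ * survival u q′))
      ≡⟨ ∑-cong (λ q → ∑-cong (λ q′ → *-assoc (μ q) (m a q q′) (survival u q′))) ⟩
    ∑ (λ q → ∑ (λ q′ → μ q * (m a q q′ * survival u q′)))
      ≡⟨ ∑-cong (λ q → *-distribˡ-∑ (μ q) (λ q′ → m a q q′ * survival u q′)) ⟨
    ∑ (λ q → μ q * survival (a ∷ u) q) ∎
    where open ≡-Reasoning

  act-++ : ∀ u v μ → act (u ++ v) μ ≡ act v (act u μ)
  act-++ u v μ = foldl-++ step μ u v

  ∑-act-≤ : ∀ u {μ} → (∀ q → 0ℚ ≤ μ q) → ∑ (act u μ) ≤ ∑ μ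
  ∑-act-≤ u {μ} 0≤μ = subst (_≤ ∑ μ) (sym (∑-act u μ))
    (∑-mono-≤ (λ q → *-≤-unit (0≤μ q) (survival≤1 u q)))

  ∑-act-< : ∀ u {μ} → (∀ q → 0ℚ ≤ μ q) → ∀ {q} → 0ℚ < μ q → Hit u q → ∑ (act u μ) < ∑ μ
  ∑-act-< u {μ} 0≤μ {q} 0<μq hit = subst (_< ∑ μ) (sym (∑-act u μ))
    (∑-mono-< (λ q → *-≤-unit (0≤μ q) (survival≤1 u q)) q (*-<-unit 0<μq hit))

  ∑-act-<⁻¹ : ∀ u {μ} → (∀ q → 0ℚ ≤ μ q) → ∑ (act u μ) < ∑ μ → ∃ λ q → 0ℚ < μ q × Hit u q
  ∑-act-<⁻¹ u {μ} 0≤μ lt =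
    let (q , ltq) = ∑-<⇒∃< (subst (_< ∑ μ) (∑-act u μ) lt)
    in q , *-<-unit⁻¹ (0≤μ q) ltq

  -- A state that cannot hit along `u` keeps all its mass; this lower bound is what refutes
  -- almost-sure hitting.
  survivor≤∑-act : ∀ u {μ} → (∀ q → 0ℚ ≤ μ q) → ∀ q → ¬ Hit u q → μ q ≤ ∑ (act u μ)
  survivor≤∑-act u {μ} 0≤μ q ¬hit = begin
    μ q                            ≡⟨ *-identityʳ (μ q) ⟨
    μ q * 1ℚ                       ≡⟨ cong (μ q *_) (¬hit⇒survival≡1 u q ¬hit) ⟨
    μ q * survival u q             ≤⟨ term≤∑ (λ q → *-nonneg (0≤μ q) (0≤survival u q)) q ⟩
    ∑ (λ q → μ q * survival u q)   ≡⟨ ∑-act u μ ⟨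
    ∑ (act u μ)                    ∎
    where
    open ≤-Reasoning
    0≤survival : ∀ u q → 0ℚ ≤ survival u q
    0≤survival []      q = nonNegative⁻¹ 1ℚ
    0≤survival (a ∷ u) q = ∑-nonneg (λ q′ → *-nonneg (0≤m a q q′) (0≤survival u q′))

  ∑-act-contracts : ∀ u {μ c} → (∀ q → 0ℚ ≤ μ q) → (∀ q → 0ℚ < μ q → survival u q ≤ c) →
    ∑ (act u μ) ≤ c * ∑ μ
  ∑-act-contracts u {μ} {c} 0≤μ bound = begin
    ∑ (act u μ)                    ≡⟨ ∑-act u μ ⟩
    ∑ (λ q → μ q * survival u q)   ≤⟨ ∑-mono-≤ pointwise ⟩
    ∑ (λ q → μ q * c)              ≡⟨ *-distribʳ-∑ c μ ⟨
    ∑ μ * c                        ≡⟨ *-comm (∑ μ) c ⟩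
    c * ∑ μ                        ∎
    where
    open ≤-Reasoning
    pointwise : ∀ q → μ q * survival u q ≤ μ q * c
    pointwise q with nonneg-cases (0≤μ q)
    ... | inj₁ 0<μq = *-monoˡ (0≤μ q) (bound q 0<μq)
    -- A state without mass contributes zero on both sides, so its survival needs no bound.
    ... | inj₂ μq≡0 rewrite μq≡0 =
      ≤-reflexive (trans (*-zeroˡ (survival u q)) (sym (*-zeroˡ c)))

  act-support⇒ : ∀ u {μ} → (∀ q → 0ℚ ≤ μ q) → ∀ {q′} → 0ℚ < act u μ q′ →
    ∃ λ q → 0ℚ < μ q × Reach u q q′
  act-support⇒ []      0≤μ {q′} pos = q′ , pos , refl
  act-support⇒ (a ∷ u) 0≤μ pos =
    let (q₁ , pos₁ , reach) = act-support⇒ u (step-nonneg 0≤μ a) pos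
        (q , posq) = ∑-positive⁻¹ pos₁
        (0<μq , 0<m) = *-positive⁻¹ (0≤μ q) (0≤m a q q₁) posq
    in q , 0<μq , q₁ , 0<m , reach

  act-support⇐ : ∀ u {μ} → (∀ q → 0ℚ ≤ μ q) → ∀ {q q′} → 0ℚ < μ q → Reach u q q′ →
    0ℚ < act u μ q′
  act-support⇐ []      0≤μ 0<μq refl = 0<μq
  act-support⇐ (a ∷ u) 0≤μ {q} 0<μq (q₁ , 0<m , reach) =
    act-support⇐ u (step-nonneg 0≤μ a)
      (∑-positive (λ q → *-nonneg (0≤μ q) (0≤m a q q₁)) q (*-positive 0<μq 0<m)) reach

  -- Behaviours of finite words

  behaviours : ℕ
  behaviours = ((2 ℕ.^ n) ℕ.^ n) ℕ.* 2 ℕ.^ n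

  behaviour : List (Fin k) → Fin behaviours
  behaviour u = combine (funToFin (λ q → subsetCode (reach? u q))) (subsetCode (hit? u))

  behaviour⇒reach : ∀ {u v} → behaviour u ≡ behaviour v → ∀ {q q′} → Reach u q q′ → Reach v q q′
  behaviour⇒reach {u} {v} eq {q} {q′} =
    subsetCode-⇒ (reach? u q) (reach? v q)
      (funToFin-injective (λ q → subsetCode (reach? u q)) (λ q → subsetCode (reach? v q))
        (proj₁ (combine-injective _ (subsetCode (hit? u)) _ (subsetCode (hit? v)) eq)) q) q′

  behaviour⇒hit : ∀ {u v} → behaviour u ≡ behaviour v → ∀ {q} → Hit u q → Hit v q
  behaviour⇒hit {u} {v} eq {q} =
    subsetCode-⇒ (hit? u) (hit? v)
      (proj₂ (combine-injective (funToFin (λ q → subsetCode (reach? u q))) _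
                                (funToFin (λ q → subsetCode (reach? v q))) _ eq)) q

  -- Both components for `a ∷ u` are computed from the row of `a` and the same components for `u`.
  behaviour-∷ : ∀ a {u v} → behaviour u ≡ behaviour v → behaviour (a ∷ u) ≡ behaviour (a ∷ v)
  behaviour-∷ a {u} {v} eq = cong₂ combine
    (funToFin-cong (λ q → ⇔⇒subsetCode-≡ (reach? (a ∷ u) q) (reach? (a ∷ v) q)
      (λ q′ → reach-∷ eq) (λ q′ → reach-∷ (sym eq))))
    (⇔⇒subsetCode-≡ (hit? (a ∷ u)) (hit? (a ∷ v)) (λ q → hit-∷ eq) (λ q → hit-∷ (sym eq)))
    where
    reach-∷ : ∀ {u v} → behaviour u ≡ behaviour v → ∀ {q q′} → Reach (a ∷ u) q q′ → Reach (a ∷ v) q q′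
    reach-∷ eq (q₁ , 0<m , reach) = q₁ , 0<m , behaviour⇒reach eq reach
    hit-∷ : ∀ {u v} → behaviour u ≡ behaviour v → ∀ {q} → Hit (a ∷ u) q → Hit (a ∷ v) q
    hit-∷ {u} {v} eq hit = hit-∷⇐ a v (map₂
      (λ (q′ , 0<m , hit′) → q′ , 0<m , behaviour⇒hit eq hit′) (hit-∷⇒ a u hit))

  open LeftCongruence behaviour behaviour-∷ public

  module FromInitial (ρ : Fin n → ℚ) (0≤ρ : ∀ q → 0ℚ ≤ ρ q) (∑ρ≡1 : ∑ ρ ≡ 1ℚ) where

    at : Word k → ℕ → Fin n → ℚ
    at w N = act (prefix w N) ρ

    mass : Word k → ℕ → ℚ
    mass w N = ∑ (at w N)

    HitsPositively : Word k → Set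
    HitsPositively w = ∃ λ N → mass w N < 1ℚ

    -- As the mass never increases with time, one small value for each `ε` says that it tends to 0.
    HitsSurely : Word k → Set
    HitsSurely w = ∀ ε → 0ℚ < ε → ∃ λ N → mass w N < ε

    Support : List (Fin k) → Fin n → Set
    Support u q′ = ∃ λ q → 0ℚ < ρ q × Reach u q q′

    support? : ∀ u → Decidable (Support u)
    support? u q′ = any? (λ q → (0ℚ <? ρ q) ×-dec reach? u q q′)

    support-resp : ∀ {u v} → behaviour u ≡ behaviour v → ∀ {q} → Support u q → Support v q
    support-resp eq (q , 0<ρq , reach) = q , 0<ρq , behaviour⇒reach eq reach

    InitialHit : List (Fin k) → Set
    InitialHit u = ∃ λ q → 0ℚ < ρ q × Hit u q

    initialHit? : Decidable InitialHit
    initialHit? u = any? (λ q → (0ℚ <? ρ q) ×-dec hit? u q)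

    initialHit-resp : ∀ {u v} → behaviour u ≡ behaviour v → InitialHit u → InitialHit v
    initialHit-resp eq (q , 0<ρq , hit) = q , 0<ρq , behaviour⇒hit eq hit

    ∑-act<1⇒ : ∀ u → ∑ (act u ρ) < 1ℚ → InitialHit u
    ∑-act<1⇒ u lt = ∑-act-<⁻¹ u 0≤ρ (subst (∑ (act u ρ) <_) (sym ∑ρ≡1) lt)

    ∑-act<1⇐ : ∀ u → InitialHit u → ∑ (act u ρ) < 1ℚ
    ∑-act<1⇐ u (q , 0<ρq , hit) = subst (∑ (act u ρ) <_) ∑ρ≡1 (∑-act-< u 0≤ρ 0<ρq hit)

    0≤at : ∀ w N q → 0ℚ ≤ at w N q
    0≤at w N = act-nonneg (prefix w N) 0≤ρ

    at-+ : ∀ w N M → at w (N ℕ.+ M) ≡ act (prefix (shift w N) M) (at w N)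
    at-+ w N M = trans (cong (λ u → act u ρ) (prefix-+ w N M)) (act-++ (prefix w N) _ ρ)

    mass-antitone : ∀ w N M → mass w (N ℕ.+ M) ≤ mass w N
    mass-antitone w N M = subst (λ μ → ∑ μ ≤ mass w N) (sym (at-+ w N M))
      (∑-act-≤ (prefix (shift w N) M) (0≤at w N))

    -- Hitting with positive probability

    some-hitsPositively? : Dec (∃ HitsPositively)
    some-hitsPositively? = map′ word-of (λ (w , N , lt) → prefix w N , ∑-act<1⇒ (prefix w N) lt)
      (search initialHit? initialHit-resp)
      where
      word-of : ∃ InitialHit → ∃ HitsPositively
      word-of ([] , q , _ , hit) = ⊥-elim (<-irrefl refl hit)
      -- Any infinite continuation of the hitting word would do. The time is written as one period
      -- to fit `prefix-cycle`.
      word-of (b ∷ y , q , 0<ρq , hit) = lasso [] b y , 1 ℕ.* length (b ∷ y) ,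
        ∑-act<1⇐ (prefix (lasso [] b y) (1 ℕ.* length (b ∷ y)))
          (subst InitialHit (sym (prefix-cycle b y 1)) (q , 0<ρq , hit-++ (b ∷ y) [] hit))

    all-hitPositively? : Dec (∀ w → HitsPositively w)
    all-hitPositively? with any-word? behaviours (¬? ∘ initialHit?)
    ... | no none = yes λ w →
      let u = prefix w behaviours
      in behaviours , ∑-act<1⇐ u (decidable-stable (initialHit? u)
           (λ ¬hit → none (u , length-applyUpTo w behaviours , ¬hit)))
    ... | yes (u , long , ¬hit) = no λ all →
      let (x , b , y , extend) = pump u (ℕₚ.≤-reflexive (sym long))
          w = lasso x b y
          (N , lt) = all w
          (v , v≡) = extend N
          (q , 0<ρq , hit) = ∑-act<1⇒ (prefix w N) lt
      -- A hit within the first `N` letters persists in the extension by `v`, which behaves like the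
      -- missing word `u`.
      in ¬hit (initialHit-resp v≡ (q , 0<ρq , hit-++ (prefix w N) v hit))

    -- Hitting almost surely along every word

    Avoids : Fin n → Set
    Avoids q = ∃ λ u → length u ≡ behaviours × ¬ Hit u q

    avoids? : Decidable Avoids
    avoids? q = any-word? behaviours (λ u → ¬? (hit? u q))

    -- Reading `x₀` puts mass on `q`; pumping the avoiding word afterwards preserves that mass for
    -- ever, so the total never falls below it.
    avoidable⇒¬all-hitSurely : ∀ x₀ q → Support x₀ q → Avoids q → ¬ (∀ w → HitsSurely w)
    avoidable⇒¬all-hitSurely x₀ q (q₀ , 0<ρq₀ , reach) (u , long , ¬hit) all =
      let (x , b , y , extend) = pump u (ℕₚ.≤-reflexive (sym long))
          w = lasso (x₀ ++ x) b y
          w′ = lasso x b y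
          (N , lt) = all w (act x₀ ρ q) (act-support⇐ x₀ 0≤ρ 0<ρq₀ reach)
          (v , v≡) = extend N
      in <⇒≱ lt (begin
           act x₀ ρ q
             ≤⟨ survivor≤∑-act (prefix w′ N) (act-nonneg x₀ 0≤ρ) q
                  (λ hit → ¬hit (behaviour⇒hit v≡ (hit-++ (prefix w′ N) v hit))) ⟩
           ∑ (act (prefix w′ N) (act x₀ ρ))
             ≡⟨ cong ∑ (act-++ x₀ (prefix w′ N) ρ) ⟨
           ∑ (act (x₀ ++ prefix w′ N) ρ)
             ≡⟨ cong (λ u → ∑ (act u ρ)) (prefix-lasso-++ x₀ x b y N) ⟨
           mass w (length x₀ ℕ.+ N)
             ≡⟨ cong (mass w) (ℕₚ.+-comm (length x₀) N) ⟩
           mass w (N ℕ.+ length x₀)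
             ≤⟨ mass-antitone w N (length x₀) ⟩
           mass w N ∎)
      where open ≤-Reasoning

    -- Contraction is needed only along a sequence of times, which may start anywhere since the mass
    -- never exceeds 1.
    vanishes-along : ∀ w {c} (t : ℕ → ℕ) → c < 1ℚ →
      (∀ j → mass w (t (suc j)) ≤ c * mass w (t j)) → HitsSurely w
    vanishes-along w t c<1 contracts ε 0<ε =
      let (j , lt) = contraction⇒vanishes (λ j → mass w (t j)) c<1
                       (λ j → ∑-nonneg (0≤at w (t j)))
                       (subst (mass w (t 0) ≤_) ∑ρ≡1 (∑-act-≤ (prefix w (t 0)) 0≤ρ))
                       contracts ε 0<ε
      in t j , lt

    unavoidable⇒all-hitSurely : (∀ x q → Support x q → ¬ Avoids q) → ∀ w → HitsSurely w
    unavoidable⇒all-hitSurely unavoidable w = vanishes-along w t c<1 contracts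
      where
      -- The contraction factor is uniform: a bound over all words of block length for each state,
      -- then a bound over the states.
      per-state = λ q → gap-words 1ℚ behaviours (λ u → survival u q)
      overall = gap 1ℚ (proj₁ ∘ per-state)
      c = proj₁ overall
      c<1 = proj₁ (proj₂ overall)

      t : ℕ → ℕ
      t j = j ℕ.* behaviours

      contracts : ∀ j → mass w (t (suc j)) ≤ c * mass w (t j)
      contracts j = subst (_≤ c * mass w (t j))
        (sym (trans (cong (mass w) (ℕₚ.+-comm behaviours (t j))) (cong ∑ (at-+ w (t j) behaviours))))
        (∑-act-contracts u (0≤at w (t j)) bound)
        where
        u = prefix (shift w (t j)) behaviours
        long = length-applyUpTo (shift w (t j)) behaviours
        bound : ∀ q → 0ℚ < at w (t j) q → survival u q ≤ c
        bound q pos = ≤-trans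
          (proj₂ (proj₂ (per-state q)) u long
            (decidable-stable (hit? u q) λ ¬hit →
              unavoidable (prefix w (t j)) q (act-support⇒ (prefix w (t j)) 0≤ρ pos) (u , long , ¬hit)))
          (proj₂ (proj₂ overall) q (proj₁ (proj₂ (per-state q))))

    all-hitSurely? : Dec (∀ w → HitsSurely w)
    all-hitSurely? with search
      (λ x → any? (λ q → support? x q ×-dec avoids? q))
      (λ eq (q , supp , avoids) → q , support-resp eq supp , avoids)
    ... | yes (x , q , supp , avoids) = no (avoidable⇒¬all-hitSurely x q supp avoids)
    ... | no none = yes (unavoidable⇒all-hitSurely (λ x q supp avoids → none (x , q , supp , avoids)))

    -- Hitting almost surely along some word

    Recurrent : List (Fin k) → List (Fin k) → Set
    Recurrent x y = ∀ q → Support x q → Hit y q × (∀ q′ → Reach y q q′ → Support x q′)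

    recurrent? : ∀ x → Decidable (Recurrent x)
    recurrent? x y = all? (λ q → support? x q →-dec
      (hit? y q ×-dec all? (λ q′ → reach? y q q′ →-dec support? x q′)))

    recurrent-respˡ : ∀ {x x′ y} → behaviour x ≡ behaviour x′ → Recurrent x y → Recurrent x′ y
    recurrent-respˡ eq rec q supp =
      let (hit , closed) = rec q (support-resp (sym eq) supp)
      in hit , λ q′ reach → support-resp eq (closed q′ reach)

    recurrent-respʳ : ∀ x {y y′} → behaviour y ≡ behaviour y′ → Recurrent x y → Recurrent x y′
    recurrent-respʳ x eq rec q supp =
      let (hit , closed) = rec q supp
      in behaviour⇒hit eq hit , λ q′ reach → closed q′ (behaviour⇒reach (sym eq) reach)

    RecurrentLasso : Set
    RecurrentLasso = ∃ λ x → ∃ λ b → ∃ λ y → Recurrent x (b ∷ y)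

    -- Nested search: for fixed `x` and `b` the certificate depends only on the behaviour of `y`,
    -- and its existence only on that of `x`.
    recurrentLasso? : Dec RecurrentLasso
    recurrentLasso? = search
      (λ x → any? (λ b → search (λ y → recurrent? x (b ∷ y))
                                (λ eq → recurrent-respʳ x (behaviour-∷ b eq))))
      (λ eq (b , y , rec) → b , y , recurrent-respˡ eq rec)

    -- After every round the support lies within that of `x`, and from each of its states the next
    -- round survives with probability at most `c`.
    recurrent⇒some-hitsSurely : RecurrentLasso → ∃ HitsSurely
    recurrent⇒some-hitsSurely (x , b , y , rec) = w , vanishes-along w t c<1 contracts
      where
      w = lasso x b y
      overall = gap 1ℚ (survival (b ∷ y))
      c = proj₁ overall
      c<1 = proj₁ (proj₂ overall)

      t : ℕ → ℕ
      t zero    = length x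
      t (suc j) = t j ℕ.+ length (b ∷ y)

      t≡ : ∀ j → t j ≡ length x ℕ.+ j ℕ.* length (b ∷ y)
      t≡ zero    = sym (ℕₚ.+-identityʳ (length x))
      t≡ (suc j) = trans (cong (ℕ._+ length (b ∷ y)) (t≡ j))
        (trans (ℕₚ.+-assoc (length x) (j ℕ.* length (b ∷ y)) (length (b ∷ y)))
               (cong (length x ℕ.+_) (ℕₚ.+-comm (j ℕ.* length (b ∷ y)) (length (b ∷ y)))))

      at-t : ∀ j → at w (t j) ≡ act (x ++ power j (b ∷ y)) ρ
      at-t j = cong (λ u → act u ρ) (trans (cong (prefix w) (t≡ j))
        (trans (prefix-lasso x b y _) (cong (x ++_) (prefix-cycle b y j))))

      power-comm : ∀ j → power (suc j) (b ∷ y) ≡ power j (b ∷ y) ++ (b ∷ y)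
      power-comm zero    = ++-identityʳ (b ∷ y)
      power-comm (suc j) = trans (cong ((b ∷ y) ++_) (power-comm j))
                                 (sym (++-assoc (b ∷ y) (power j (b ∷ y)) (b ∷ y)))

      at-suc : ∀ j → at w (t (suc j)) ≡ act (b ∷ y) (at w (t j))
      at-suc j = begin
        at w (t (suc j))                                 ≡⟨ at-t (suc j) ⟩
        act (x ++ power (suc j) (b ∷ y)) ρ               ≡⟨ cong (λ u → act (x ++ u) ρ) (power-comm j) ⟩
        act (x ++ power j (b ∷ y) ++ (b ∷ y)) ρ          ≡⟨ cong (λ u → act u ρ) (++-assoc x _ (b ∷ y)) ⟨
        act ((x ++ power j (b ∷ y)) ++ (b ∷ y)) ρ        ≡⟨ act-++ (x ++ power j (b ∷ y)) (b ∷ y) ρ ⟩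
        act (b ∷ y) (act (x ++ power j (b ∷ y)) ρ)       ≡⟨ cong (act (b ∷ y)) (at-t j) ⟨
        act (b ∷ y) (at w (t j))                         ∎
        where open ≡-Reasoning

      support-invariant : ∀ j q → 0ℚ < at w (t j) q → Support x q
      support-invariant zero q pos = act-support⇒ x 0≤ρ
        (subst (λ u → 0ℚ < act u ρ q) prefix≡x pos)
        where
        prefix≡x : prefix w (length x) ≡ x
        prefix≡x = trans (cong (prefix w) (t≡ 0)) (trans (prefix-lasso x b y 0) (++-identityʳ x))
      support-invariant (suc j) q pos =
        let (q₁ , pos₁ , reach) = act-support⇒ (b ∷ y) (0≤at w (t j))
                                    (subst (λ μ → 0ℚ < μ q) (at-suc j) pos)
        in proj₂ (rec q₁ (support-invariant j q₁ pos₁)) q reach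

      contracts : ∀ j → mass w (t (suc j)) ≤ c * mass w (t j)
      contracts j = subst (λ μ → ∑ μ ≤ c * mass w (t j)) (sym (at-suc j))
        (∑-act-contracts (b ∷ y) (0≤at w (t j)) (λ q pos →
          proj₂ (proj₂ overall) q (proj₁ (rec q (support-invariant j q pos)))))

    -- From every time N, all states of the current support have a chance to hit before a
    -- common later time; two such times with equal supports delimit the cycle.
    some-hitsSurely⇒recurrent : ∃ HitsSurely → RecurrentLasso
    some-hitsSurely⇒recurrent (w , surely) =
      let (i , j , i<j , same) =
            pigeonhole (ℕₚ.n<1+n behaviours) (λ i → behaviour (prefix w (time (toℕ i))))
      in cycle (toℕ i) (toℕ j) i<j same
      where
      -- States without mass satisfy this vacuously, so every state has a bound and `common-bound`
      -- applies.
      HitsWithin : ℕ → Fin n → ℕ → Set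
      HitsWithin N q d = 0ℚ < at w N q → Hit (prefix (shift w N) d) q

      within-mono : ∀ N q d e → HitsWithin N q d → HitsWithin N q (d ℕ.+ e)
      within-mono N q d e hits pos = subst (λ u → Hit u q) (sym (prefix-+ (shift w N) d e))
        (hit-++ (prefix (shift w N) d) (prefix (shift (shift w N) d) e) (hits pos))

      eventually : ∀ N q → ∃ (HitsWithin N q)
      eventually N q with 0ℚ <? at w N q
      ... | no  ¬pos = 0 , λ pos → ⊥-elim (¬pos pos)
      ... | yes pos  =
        -- The mass at `q` itself is taken as `ε`: were there no hit from `q` within `M` letters,
        -- that mass would remain at time `N + M`, and so bound the mass at `M` from below.
        let (M , lt) = surely (at w N q) pos
        in M , λ _ → decidable-stable (hit? (prefix (shift w N) M) q) λ ¬hit →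
             <⇒≱ lt (begin
               at w N q
                 ≤⟨ survivor≤∑-act (prefix (shift w N) M) (0≤at w N) q ¬hit ⟩
               ∑ (act (prefix (shift w N) M) (at w N))
                 ≡⟨ cong ∑ (at-+ w N M) ⟨
               mass w (N ℕ.+ M)
                 ≡⟨ cong (mass w) (ℕₚ.+-comm N M) ⟩
               mass w (M ℕ.+ N)
                 ≤⟨ mass-antitone w M N ⟩
               mass w M ∎)
        where open ≤-Reasoning

      window : ∀ N → ∃ λ d → ∀ q → HitsWithin N q d
      window N = common-bound (HitsWithin N) (within-mono N) (eventually N)

      time : ℕ → ℕ
      time zero    = 0
      -- The additional letter makes the times strictly increasing, so that periods are nonempty.
      time (suc i) = time i ℕ.+ suc (proj₁ (window (time i)))

      time-mono : ∀ i e → ∃ λ d → time (e ℕ.+ i) ≡ time i ℕ.+ d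
      time-mono i zero    = 0 , sym (ℕₚ.+-identityʳ (time i))
      time-mono i (suc e) =
        let (d , eq) = time-mono i e
            l = suc (proj₁ (window (time (e ℕ.+ i))))
        in d ℕ.+ l , trans (cong (ℕ._+ l) eq) (ℕₚ.+-assoc (time i) d l)

      cycle : ∀ i j → i ℕ.< j → behaviour (prefix w (time i)) ≡ behaviour (prefix w (time j)) →
        RecurrentLasso
      -- The period is `y` below, split into head and tail; its head `shift w N 0` unfolds to
      -- `w (N + 0)`.
      cycle i j i<j same = x , w (N ℕ.+ 0) , prefix (shift w N ∘ suc) D , recurrent
        where
        N = time i
        x = prefix w N
        d = proj₁ (window N)
        later = time-mono (suc i) (j ℕ.∸ suc i)
        -- The window after `N` and the remaining distance to `time j`, so that the period contains
        -- the window.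
        D = d ℕ.+ proj₁ later
        y = prefix (shift w N) (suc D)

        time-j : time j ≡ N ℕ.+ suc D
        time-j = trans (cong time (sym (ℕₚ.m∸n+n≡m i<j)))
          (trans (proj₂ later) (ℕₚ.+-assoc N (suc d) (proj₁ later)))

        recurrent : Recurrent x y
        recurrent q supp@(q₀ , 0<ρq₀ , reach₀) = hit , closed
          where
          0<at : 0ℚ < at w N q
          0<at = act-support⇐ x 0≤ρ 0<ρq₀ reach₀
          hit : Hit y q
          hit = subst (λ L → Hit (prefix (shift w N) L) q) (ℕₚ.+-suc d (proj₁ later))
            (within-mono N q d (suc (proj₁ later)) (proj₂ (window N) q) 0<at)
          closed : ∀ q′ → Reach y q q′ → Support x q′
          -- Reading `y` leads from `time i` to `time j`, where the support is that of `x` again.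
          closed q′ reach = support-resp (sym same)
            (act-support⇒ (prefix w (time j)) 0≤ρ (subst (λ μ → 0ℚ < μ q′)
              (sym (trans (cong (at w) time-j) (at-+ w N (suc D))))
              (act-support⇐ y (0≤at w N) 0<at reach)))

    some-hitsSurely? : Dec (∃ HitsSurely)
    some-hitsSurely? = map′ recurrent⇒some-hitsSurely some-hitsSurely⇒recurrent recurrentLasso?

-- Probabilistic weighted automata

0≤[<] : ∀ x y → 0ℚ ≤ [ x < y ]
0≤[<] x y with x <? y
... | yes _ = nonNegative⁻¹ 1ℚ
... | no  _ = ≤-refl

[<]≤1 : ∀ x y → [ x < y ] ≤ 1ℚ
[<]≤1 x y with x <? y
... | yes _ = ≤-refl
... | no  _ = nonNegative⁻¹ 1ℚ

[<]-mono : ∀ {x y x′ y′} → (x < y → x′ < y′) → [ x < y ] ≤ [ x′ < y′ ]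
[<]-mono {x} {y} {x′} {y′} f with x <? y | x′ <? y′
... | yes _   | yes _  = ≤-refl
... | no  _   | no  _  = ≤-refl
... | no  _   | yes _  = nonNegative⁻¹ 1ℚ
... | yes x<y | no  ≮  = ⊥-elim (≮ (f x<y))

module Automaton {nQ nΣ : ℕ} (A : PWA nQ nΣ) where
  open PWA A

  0≤noHit : ∀ w η N q → 0ℚ ≤ noHit A w η N q
  0≤noHit w η zero    q  = proj₁ ρI-dist q
  0≤noHit w η (suc N) q′ = ∑-nonneg (λ q → *-nonneg (0≤noHit w η N q)
    (*-nonneg (proj₁ (δ-dist q (w N)) q′) (0≤[<] (γ q (w N) q′) η)))

  noHit-mono : ∀ w {η η′} → (∀ q a q′ → γ q a q′ < η → γ q a q′ < η′) →
    ∀ N q → noHit A w η N q ≤ noHit A w η′ N q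
  noHit-mono w imp zero    q  = ≤-refl
  noHit-mono w {η} {η′} imp (suc N) q′ = ∑-mono-≤ λ q →
    ≤-trans (*-monoʳ-≤-nonNeg _ {{0≤⇒NonNegative (*-nonneg (0≤δ q) (0≤[<] (γ q (w N) q′) η))}}
                              (noHit-mono w imp N q))
            (*-monoˡ (0≤noHit w η′ N q) (*-monoˡ (0≤δ q) ([<]-mono (imp q (w N) q′))))
    where
    0≤δ : ∀ q → 0ℚ ≤ δ q (w N) q′
    0≤δ q = proj₁ (δ-dist q (w N)) q′

  probHitBy-mono : ∀ w {η η′} → (∀ q a q′ → γ q a q′ < η → γ q a q′ < η′) →
    ∀ N → probHitBy A w η′ N ≤ probHitBy A w η N
  probHitBy-mono w imp N = +-monoʳ-≤ 1ℚ (neg-antimono-≤ (∑-mono-≤ (noHit-mono w imp N)))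

  -- Thresholds are compared only on weights that occur, so an event also passes to a larger
  -- threshold if no weight lies in between.
  event-mono : ∀ s w {η η′} → (∀ q a q′ → γ q a q′ < η → γ q a q′ < η′) →
    Event s A w η′ → Event s A w η
  event-mono positive   w imp (N , pos) = N , <-≤-trans pos (probHitBy-mono w imp N)
  event-mono almostSure w imp sure ε 0<ε =
    let (N , lt) = sure ε 0<ε in N , <-≤-trans lt (probHitBy-mono w imp N)

  -- No weight lies strictly between the returned c and ν.
  weight-gap : ∀ ν → ∃ λ c → c < ν × (∀ q a q′ → γ q a q′ < ν → γ q a q′ ≤ c)
  weight-gap ν =
    let g  = λ q a → gap ν (γ q a)
        g′ = λ q → gap ν (proj₁ ∘ g q)
        (c , c<ν , bound) = gap ν (proj₁ ∘ g′)
    in c , c<ν , λ q a q′ lt →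
         ≤-trans (proj₂ (proj₂ (g q a)) q′ lt)
        (≤-trans (proj₂ (proj₂ (g′ q)) a (proj₁ (proj₂ (g q a))))
                 (bound q (proj₁ (proj₂ (g′ q)))))

  -- Testing the supremum at the gap bound `c` yields an event above `c`; a weight below `ν` is at
  -- most `c`, hence below that event's threshold.
  valueGeq⇒event : ∀ s w ν → ValueGeq s A w ν → Event s A w ν
  valueGeq⇒event s w ν geq =
    let (c , c<ν , bound) = weight-gap ν
        (η , c<η , event) = geq c c<ν
    in event-mono s w (λ q a q′ lt → ≤-<-trans (bound q a q′ lt) c<η) event

  event⇒valueGeq : ∀ s w ν → Event s A w ν → ValueGeq s A w ν
  event⇒valueGeq s w ν event η η<ν = ν , η<ν , event

  module Threshold (ν : ℚ) where

    -- Transitions of weight at least `ν` are removed, so the mass lost in a row is the probability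
    -- of hitting at that step.
    kernel : Fin nΣ → Fin nQ → Fin nQ → ℚ
    kernel a q q′ = δ q a q′ * [ γ q a q′ < ν ]

    0≤kernel : ∀ a q q′ → 0ℚ ≤ kernel a q q′
    0≤kernel a q q′ = *-nonneg (proj₁ (δ-dist q a) q′) (0≤[<] (γ q a q′) ν)

    kernel-row : ∀ a q → ∑ (kernel a q) ≤ 1ℚ
    kernel-row a q = subst (∑ (kernel a q) ≤_) (proj₂ (δ-dist q a))
      (∑-mono-≤ (λ q′ → *-≤-unit (proj₁ (δ-dist q a) q′) ([<]≤1 (γ q a q′) ν)))

    open Substochastic kernel 0≤kernel kernel-row
    open FromInitial ρI (proj₁ ρI-dist) (proj₂ ρI-dist)

    -- `noHit` grows at the last letter while `prefix` unfolds from the first; the two meet in the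
    -- snoc form of the prefix.
    noHit≡at : ∀ w N → noHit A w ν N ≡ at w N
    noHit≡at w zero    = refl
    noHit≡at w (suc N) = begin
      step (noHit A w ν N) (w N)          ≡⟨ cong (λ μ → step μ (w N)) (noHit≡at w N) ⟩
      step (at w N) (w N)                 ≡⟨ act-++ (prefix w N) (w N ∷ []) ρI ⟨
      act (prefix w N ∷ʳ w N) ρI          ≡⟨ cong (λ u → act u ρI) (applyUpTo-∷ʳ w N) ⟩
      at w (suc N)                        ∎
      where open ≡-Reasoning

    probHitBy≡ : ∀ w N → probHitBy A w ν N ≡ 1ℚ - mass w N
    probHitBy≡ w N = cong (λ μ → 1ℚ - ∑ μ) (noHit≡at w N)

    posProb⇒ : ∀ {w} → PosProb A w ν → HitsPositively w
    posProb⇒ {w} (N , pos) = N , 0<q-p⇒p<q (subst (0ℚ <_) (probHitBy≡ w N) pos)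

    posProb⇐ : ∀ {w} → HitsPositively w → PosProb A w ν
    posProb⇐ {w} (N , lt) = N , subst (0ℚ <_) (sym (probHitBy≡ w N)) (p<q⇒0<q-p lt)

    asProb⇒ : ∀ {w} → AsProb A w ν → HitsSurely w
    asProb⇒ {w} sure ε 0<ε =
      let (N , lt) = sure ε 0<ε
      in N , ≰⇒> λ ε≤mass →
           <⇒≱ (subst (1ℚ - ε <_) (probHitBy≡ w N) lt) (+-monoʳ-≤ 1ℚ (neg-antimono-≤ ε≤mass))

    asProb⇐ : ∀ {w} → HitsSurely w → AsProb A w ν
    asProb⇐ {w} sure ε 0<ε =
      let (N , lt) = sure ε 0<ε
      in N , subst (1ℚ - ε <_) (sym (probHitBy≡ w N)) (+-monoʳ-< 1ℚ (neg-antimono-< lt))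

    some-event? : ∀ s → Dec (∃ λ w → Event s A w ν)
    some-event? positive   = map′ (λ (w , e) → w , posProb⇐ e) (λ (w , e) → w , posProb⇒ e)
                             some-hitsPositively?
    some-event? almostSure = map′ (λ (w , e) → w , asProb⇐ e) (λ (w , e) → w , asProb⇒ e)
                             some-hitsSurely?

    all-event? : ∀ s → Dec (∀ w → Event s A w ν)
    all-event? positive   = map′ (λ e w → posProb⇐ (e w)) (λ e w → posProb⇒ (e w)) all-hitPositively?
    all-event? almostSure = map′ (λ e w → asProb⇐ (e w)) (λ e w → asProb⇒ (e w)) all-hitSurely?

    nonEmpty? : ∀ s → Dec (NonEmpty s A ν)
    nonEmpty? s = map′ (λ (w , e) → w , event⇒valueGeq s w ν e)
                       (λ (w , geq) → w , valueGeq⇒event s w ν geq) (some-event? s)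

    universal? : ∀ s → Dec (Universal s A ν)
    universal? s = map′ (λ e w → event⇒valueGeq s w ν (e w))
                        (λ geq w → valueGeq⇒event s w ν (geq w)) (all-event? s)

theorem6 : (s : Semantics) →
    ((nQ nΣ : ℕ) (A : PWA nQ nΣ) (ν : ℚ) → Dec (NonEmpty s A ν))
    × ((nQ nΣ : ℕ) (A : PWA nQ nΣ) (ν : ℚ) → Dec (Universal s A ν))
theorem6 s = (λ nQ nΣ A ν → nonEmpty? A ν s) , (λ nQ nΣ A ν → universal? A ν s)
  where
  open Automaton using (module Threshold)
  open Threshold using (nonEmpty?; universal?)
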